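{- For every integer $n\ge 2$, the $n$-grid $G_{n,n}$ has a spanning tree $T$ such that the average length of a fundamental cycle with respect to $T$ is at most $40\log_2 n$.
   Context: The $n$-grid $G_{n,n}$ is the Cartesian product of two $n$-vertex paths. If $T$ is a spanning tree of a graph $G$ and $e$ is an edge of $G$ not contained in $T$, the fundamental cycle associated with $e$ (with respect to $T$) is the cycle formed by $e$ and the unique path of $T$ joining the two end vertices of $e$. Its length is its number of edges. The average length of a fundamental cycle with respect to $T$ is the arithmetic mean of the lengths of the fundamental cycles associated with all edges of $G$ not contained in $T$. -}

module Defs where

open import Data.Fin using (Fin; toℕ)
import Data.Fin.Properties as Fin
open import Data.Integer using (+_; -[1+_])
open import Data.List using (List; []; _∷_; _++_; map; mapMaybe; length; allFin; cartesianProduct)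
open import Data.List.Membership.Propositional using (_∈_)
open import Data.List.Membership.Propositional.Properties using (∈-allFin; ∈-cartesianProduct⁺)
open import Data.List.Relation.Unary.Unique.Propositional using (Unique)
open import Data.List.Relation.Unary.Unique.Propositional.Properties using (allFin⁺; cartesianProduct⁺)
open import Data.Maybe using (Maybe; just; nothing)
open import Data.Nat using (ℕ; suc; _≤_; _*_; _^_; z≤n; s≤s)
open import Data.Nat.ListAction using (sum)
import Data.Nat.Properties as ℕ
open import Data.Product using (_×_; _,_)
open import Data.Product.Properties using (≡-dec)
open import Data.Rational.Unnormalised using (ℚᵘ; mkℚᵘ; 0ℚᵘ; _/_)
open import Data.Sum using (_⊎_; inj₁; inj₂; swap)
open import Relation.Binary.Construct.Closure.ReflexiveTransitive as Star using (Star; ε; _◅_)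
open import Relation.Binary.Definitions using (DecidableEquality)
open import Relation.Binary.PropositionalEquality using (_≡_; refl; sym; cong; subst)
open import Relation.Nullary using (¬_; Dec; yes; no; contradiction)
open import Relation.Nullary.Decidable using (_×-dec_; _⊎-dec_)

record FiniteSet : Set₁ where
  field
    Carrier  : Set
    _≟_      : DecidableEquality Carrier
    elements : List Carrier
    complete : ∀ x → x ∈ elements
    unique   : Unique elements

open FiniteSet using (Carrier; elements)

FinSet : ℕ → FiniteSet
FinSet n = record
  { Carrier  = Fin n
  ; _≟_      = Fin._≟_
  ; elements = allFin n
  ; complete = ∈-allFin
  ; unique   = allFin⁺ n
  }

_×ᶠ_ : FiniteSet → FiniteSet → FiniteSet
A ×ᶠ B = record
  { Carrier  = A.Carrier × B.Carrier
  ; _≟_      = ≡-dec A._≟_ B._≟_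
  ; elements = cartesianProduct A.elements B.elements
  ; complete = λ (a , b) → ∈-cartesianProduct⁺ (A.complete a) (B.complete b)
  ; unique   = cartesianProduct⁺ A.unique B.unique
  }
  where
  module A = FiniteSet A
  module B = FiniteSet B

-- Finite simple undirected graphs with vertex set V.
record Graph (V : FiniteSet) : Set₁ where
  field
    Adj        : Carrier V → Carrier V → Set
    Adj?       : ∀ u v → Dec (Adj u v)
    Adj-sym    : ∀ {u v} → Adj u v → Adj v u
    Adj-irrefl : ∀ {v} → ¬ Adj v v

open Graph

pathGraph : (n : ℕ) → Graph (FinSet n)
pathGraph n = record
  { Adj        = λ i j → toℕ j ≡ suc (toℕ i) ⊎ toℕ i ≡ suc (toℕ j)
  ; Adj?       = λ i j → (toℕ j ℕ.≟ suc (toℕ i)) ⊎-dec (toℕ i ℕ.≟ suc (toℕ j))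
  ; Adj-sym    = swap
  ; Adj-irrefl = λ { (inj₁ p) → ℕ.1+n≢n (sym p) ; (inj₂ p) → ℕ.1+n≢n (sym p) }
  }

_□_ : ∀ {V W} → Graph V → Graph W → Graph (V ×ᶠ W)
_□_ {V} {W} G H = record
  { Adj        = λ (u , x) (v , y) → (Adj G u v × x ≡ y) ⊎ (u ≡ v × Adj H x y)
  ; Adj?       = λ (u , x) (v , y) → (Adj? G u v ×-dec (x W.≟ y)) ⊎-dec ((u V.≟ v) ×-dec Adj? H x y)
  ; Adj-sym    = λ { (inj₁ (a , p)) → inj₁ (Adj-sym G a , sym p)
                   ; (inj₂ (p , a)) → inj₂ (sym p , Adj-sym H a) }
  ; Adj-irrefl = λ { (inj₁ (a , _)) → Adj-irrefl G a ; (inj₂ (_ , a)) → Adj-irrefl H a }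
  }
  where
  module V = FiniteSet V
  module W = FiniteSet W

grid : (n : ℕ) → Graph (FinSet n ×ᶠ FinSet n)
grid n = pathGraph n □ pathGraph n

module _ {V : FiniteSet} where

  Walk : Graph V → Carrier V → Carrier V → Set
  Walk G = Star (Adj G)

  walkVertices : ∀ (G : Graph V) {u v} → Walk G u v → List (Carrier V)
  walkVertices G {u} ε       = u ∷ []
  walkVertices G {u} (_ ◅ w) = u ∷ walkVertices G w

  walkLength : ∀ (G : Graph V) {u v} → Walk G u v → ℕ
  walkLength G ε       = 0
  walkLength G (_ ◅ w) = suc (walkLength G w)

  record Path (G : Graph V) (u v : Carrier V) : Set where
    field
      walk   : Walk G u v
      simple : Unique (walkVertices G walk)

  pathLength : ∀ {G : Graph V} {u v} → Path G u v → ℕ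
  pathLength {G} p = walkLength G (Path.walk p)

  -- A path on at least three vertices together with an edge joining its ends.
  record Cycle (G : Graph V) : Set where
    field
      {source target} : Carrier V
      path            : Path G source target
      long            : 2 ≤ pathLength path
      closing         : Adj G target source

  cycleLength : ∀ {G : Graph V} → Cycle G → ℕ
  cycleLength c = suc (pathLength (Cycle.path c))

  Connected : Graph V → Set
  Connected G = ∀ u v → Path G u v

  Acyclic : Graph V → Set
  Acyclic G = ¬ Cycle G

  _⊆ᴳ_ : Graph V → Graph V → Set
  H ⊆ᴳ G = ∀ {u v} → Adj H u v → Adj G u v

  -- The tree has the same vertex set V as G, so it spans G by construction.
  record SpanningTree (G : Graph V) : Set₁ where
    field
      tree      : Graph V
      subgraph  : tree ⊆ᴳ G
      connected : Connected tree
      acyclic   : Acyclic tree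

  module _ {H G : Graph V} (H⊆G : H ⊆ᴳ G) where

    liftWalk : ∀ {u v} → Walk H u v → Walk G u v
    liftWalk = Star.map H⊆G

    walkVertices-lift : ∀ {u v} (w : Walk H u v) → walkVertices G (liftWalk w) ≡ walkVertices H w
    walkVertices-lift ε       = refl
    walkVertices-lift (_ ◅ w) = cong (_ ∷_) (walkVertices-lift w)

    walkLength-lift : ∀ {u v} (w : Walk H u v) → walkLength G (liftWalk w) ≡ walkLength H w
    walkLength-lift ε       = refl
    walkLength-lift (_ ◅ w) = cong suc (walkLength-lift w)

    liftPath : ∀ {u v} → Path H u v → Path G u v
    liftPath p = record
      { walk   = liftWalk (Path.walk p)
      ; simple = subst Unique (sym (walkVertices-lift (Path.walk p))) (Path.simple p)
      }

  module _ {G : Graph V} (T : SpanningTree G) where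
    open SpanningTree T

    record NonTreeEdge : Set where
      field
        end₁ end₂ : Carrier V
        isEdge    : Adj G end₁ end₂
        notInTree : ¬ Adj tree end₁ end₂

    -- `connected` supplies the tree path between the ends; by `acyclic` it is the only one.
    fundamentalCycle : NonTreeEdge → Cycle G
    fundamentalCycle e = record
      { path    = liftPath subgraph treePath
      ; long    = subst (2 ≤_) (sym (walkLength-lift subgraph (Path.walk treePath))) (long (Path.walk treePath) isEdge notInTree)
      ; closing = Adj-sym G isEdge
      }
      where
      open NonTreeEdge e
      treePath : Path tree end₁ end₂
      treePath = connected end₁ end₂
      long : ∀ {u v} (w : Walk tree u v) → Adj G u v → ¬ Adj tree u v → 2 ≤ walkLength tree w
      long ε           uv _  = contradiction uv (Adj-irrefl G)
      long (a ◅ ε)     _  na = contradiction a na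
      long (_ ◅ _ ◅ _) _  _  = s≤s (s≤s z≤n)

-- Applied to a duplicate-free list, each 2-element subset occurs exactly once.
unorderedPairs : {A : Set} → List A → List (A × A)
unorderedPairs []       = []
unorderedPairs (x ∷ xs) = map (x ,_) xs ++ unorderedPairs xs

module _ {V : FiniteSet} {G : Graph V} (T : SpanningTree G) where
  open SpanningTree T using (tree)

  nonTreeEdge? : Carrier V × Carrier V → Maybe (NonTreeEdge T)
  nonTreeEdge? (u , v) with Adj? G u v | Adj? tree u v
  ... | yes a | no na = just (record { end₁ = u ; end₂ = v ; isEdge = a ; notInTree = na })
  ... | yes _ | yes _ = nothing
  ... | no _  | _     = nothing

  -- Every edge of G outside T occurs exactly once, in one of its two orientations.
  nonTreeEdges : List (NonTreeEdge T)
  nonTreeEdges = mapMaybe nonTreeEdge? (unorderedPairs (elements V))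

-- The value on [] is a dummy.  It is never used for a spanning tree of a graph containing
-- a cycle, such as the n-grid with n ≥ 2, since then some edge lies outside the tree.
mean : List ℕ → ℚᵘ
mean []         = 0ℚᵘ
mean xs@(_ ∷ _) = + sum xs / length xs

averageFundamentalCycleLength : {V : FiniteSet} {G : Graph V} → SpanningTree G → ℚᵘ
averageFundamentalCycleLength T = mean (map (λ e → cycleLength (fundamentalCycle T e)) (nonTreeEdges T))

-- q ≤[ c ·log₂ n ] is the comparison q ≤ c · log₂ n of real numbers, for n ≥ 1.
-- With q = a / b and b > 0 it says a ≤ (c b) log₂ n, that is 2 ^ a ≤ n ^ (c b);
-- for a = -(1 + k) the negative power of 2 is moved to the other side.
-- (The second argument of mkℚᵘ is b - 1.)
_≤[_·log₂_] : ℚᵘ → ℕ → ℕ → Set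
mkℚᵘ (+ a)    b-1 ≤[ c ·log₂ n ] = 2 ^ a ≤ n ^ (c * suc b-1)
mkℚᵘ -[1+ k ] b-1 ≤[ c ·log₂ n ] = 1 ≤ n ^ (c * suc b-1) * 2 ^ suc k

{-# OPTIONS --safe #-}

-- Orient each vertex (i , j) ≠ (0 , 0) of ℕ × ℕ towards (i , j − 1) if the 2-adic valuation of j
-- is at most that of i, and towards (i − 1 , j) otherwise.  Parents never have larger coordinates,
-- so this tree restricts to every grid.  It is self-similar: the tree path from (i , j) down to
-- (i′ , j′), scaled by 2, is the tree path from (2i , 2j) down to (2i′ , 2j′).  Hence the descent
-- from a vertex passes through the lower left corner of each dyadic 2ᵏ × 2ᵏ block containing it,
-- and two neighbours whose coordinates in the differing direction are j − 1 and j meet in the corner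
-- of a common block of side 2·2^ν(j), which bounds their fundamental cycle by 8·2^ν(j).
-- Each (i , j) with i, j ≥ 1 owns exactly one non-tree edge, the one to its non-parent predecessor,
-- so there are (n − 1)² of them; since Σ_{0<j<n} 2^ν(j) = O(n log n), the average is O(log n).
module Submission where

open import Defs
open import Data.Fin using (Fin; toℕ; fromℕ<)
open import Data.Fin.Properties using (toℕ-injective; toℕ-fromℕ<; toℕ<n)
open import Data.List using (List; []; _∷_; _++_; map; mapMaybe; length; downFrom; cartesianProduct)
open import Data.List.Properties using (map-++; map-∘; length-map; length-++; length-downFrom)
import Data.List.Membership.DecPropositional as DecMembership
open import Data.List.Membership.Propositional using (_∈_; _∉_)
open import Data.List.Membership.Propositional.Properties using (∈-map⁺; ∈-map⁻; ∈-++⁺ˡ; ∈-++⁺ʳ; ∈-++⁻; ∈-cartesianProduct⁺; ∈-cartesianProduct⁻; ∈-downFrom⁺; ∈-downFrom⁻)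
open import Data.List.Membership.Propositional.Properties.WithK using (unique∧set⇒bag)
open import Data.List.Relation.Binary.BagAndSetEquality using (∼bag⇒↭)
open import Data.List.Relation.Binary.Permutation.Propositional using (_↭_)
import Data.List.Relation.Binary.Permutation.Propositional.Properties as ↭
open import Data.List.Relation.Unary.All as All using (All; []; _∷_)
import Data.List.Relation.Unary.All.Properties as All
open import Data.List.Relation.Unary.AllPairs as AllPairs using (AllPairs; []; _∷_)
import Data.List.Relation.Unary.AllPairs.Properties as AllPairs
open import Data.List.Relation.Unary.Any using (here; there)
open import Data.List.Relation.Unary.Unique.Propositional using (Unique)
open import Data.List.Relation.Unary.Unique.Propositional.Properties using (cartesianProduct⁺; downFrom⁺)
open import Data.Maybe using (Maybe; just; nothing)
open import Data.Nat using (ℕ; zero; suc; _+_; _*_; _^_; _≤_; _<_; _<?_; z≤n; s≤s; s≤s⁻¹)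
open import Data.Nat.Divisibility using (_∣_; _∤_; _∣?_; divides; 1∣_; 0∣⇒≡0; _∣0; *-cancelˡ-∣; *-monoʳ-∣; m*n∣⇒m∣)
open import Data.Nat.ListAction using (sum)
open import Data.Nat.ListAction.Properties using (sum-++; sum-↭)
open import Data.Nat.Properties
open import Data.Nat.Tactic.RingSolver using (solve-∀)
open import Data.Product as Product using (Σ; Σ-syntax; _×_; _,_; ∃; ∃₂; proj₁; proj₂)
open import Data.Sum as Sum using (_⊎_; inj₁; inj₂; [_,_])
open import Function using (_∘_; mk⇔)
open import Relation.Binary.Construct.Closure.ReflexiveTransitive using (Star; ε; _◅_; _◅◅_; kleisliStar)
open import Relation.Binary.PropositionalEquality using (_≡_; _≢_; refl; sym; trans; cong; cong₂; subst; subst₂; module ≡-Reasoning)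
open import Relation.Nullary using (¬_; Dec; yes; no; contradiction)
open import Relation.Nullary.Decidable using (map′; ¬?; _×-dec_; _⊎-dec_)

open FiniteSet using (Carrier)
open Graph

-- Unordered pairs, filtered lists, and sums over products

∉⇒All≢ : {A : Set} {x : A} {xs : List A} → x ∉ xs → All (x ≢_) xs
∉⇒All≢ = All.¬Any⇒All¬ _

All≢⇒∉ : {A : Set} {x : A} {xs : List A} → All (x ≢_) xs → x ∉ xs
All≢⇒∉ = All.All¬⇒¬Any

module _ {A : Set} where

  -- Equality of unordered pairs. The orientation in which an edge is listed depends on the order of
  -- the vertex list, so edges are compared only up to a swap.
  SamePair : A × A → A × A → Set
  SamePair p q = p ≡ q ⊎ p ≡ Product.swap q

  unorderedPairs-∈ : ∀ {x y : A} {xs} → (x , y) ∈ unorderedPairs xs → x ∈ xs × y ∈ xs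
  unorderedPairs-∈ {xs = z ∷ xs} p with ∈-++⁻ (map (z ,_) xs) p
  ... | inj₁ q with _ , y∈ , refl ← ∈-map⁻ (z ,_) q = here refl , there y∈
  ... | inj₂ q with x∈ , y∈ ← unorderedPairs-∈ q = there x∈ , there y∈

  unorderedPairs-complete : ∀ {x y : A} {xs} → x ≢ y → x ∈ xs → y ∈ xs →
                            (x , y) ∈ unorderedPairs xs ⊎ (y , x) ∈ unorderedPairs xs
  unorderedPairs-complete x≢y (here refl) (here refl) = contradiction refl x≢y
  unorderedPairs-complete x≢y (here refl) (there y∈)  = inj₁ (∈-++⁺ˡ (∈-map⁺ _ y∈))
  unorderedPairs-complete x≢y (there x∈)  (here refl) = inj₂ (∈-++⁺ˡ (∈-map⁺ _ x∈))
  unorderedPairs-complete {xs = z ∷ xs} x≢y (there x∈) (there y∈) =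
    Sum.map (∈-++⁺ʳ (map (z ,_) xs)) (∈-++⁺ʳ (map (z ,_) xs)) (unorderedPairs-complete x≢y x∈ y∈)

  unorderedPairs-distinct : ∀ {xs : List A} → Unique xs → AllPairs (λ p q → ¬ SamePair p q) (unorderedPairs xs)
  unorderedPairs-distinct [] = []
  unorderedPairs-distinct {x ∷ xs} (x∉ ∷ u) =
    AllPairs.++⁺ (AllPairs.map⁺ (star x∉ u)) (unorderedPairs-distinct u)
      (All.map⁺ (All.tabulate λ _ → All.tabulate λ q∈ →
        λ { (inj₁ refl) → All≢⇒∉ x∉ (proj₁ (unorderedPairs-∈ q∈))
          ; (inj₂ refl) → All≢⇒∉ x∉ (proj₂ (unorderedPairs-∈ q∈)) }))
    where
    star : ∀ {x ys} → All (x ≢_) ys → Unique ys → AllPairs (λ y z → ¬ SamePair (x , y) (x , z)) ys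
    star []         []      = []
    star (x≢ ∷ x∉) (y∉ ∷ u) = All.map (λ y≢z → λ { (inj₁ refl) → y≢z refl ; (inj₂ refl) → x≢ refl }) y∉ ∷ star x∉ u

module _ {A B : Set} (f : A → Maybe B) where

  mapMaybe-∈⁺ : ∀ {x y xs} → f x ≡ just y → x ∈ xs → y ∈ mapMaybe f xs
  mapMaybe-∈⁺ {x} eq (here refl) with f x | eq
  ... | just _ | refl = here refl
  mapMaybe-∈⁺ {xs = z ∷ _} eq (there x∈) with f z
  ... | just _  = there (mapMaybe-∈⁺ eq x∈)
  ... | nothing = mapMaybe-∈⁺ eq x∈

  mapMaybe-All : ∀ {P : A → Set} {Q : B → Set} → (∀ {x y} → f x ≡ just y → P x → Q y) →
                 ∀ {xs} → All P xs → All Q (mapMaybe f xs)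
  mapMaybe-All g [] = []
  mapMaybe-All g {x ∷ _} (px ∷ ps) with f x in eq
  ... | just _  = g eq px ∷ mapMaybe-All g ps
  ... | nothing = mapMaybe-All g ps

  mapMaybe-AllPairs : ∀ {R : A → A → Set} {S : B → B → Set} →
                      (∀ {x x′ y y′} → f x ≡ just y → f x′ ≡ just y′ → R x x′ → S y y′) →
                      ∀ {xs} → AllPairs R xs → AllPairs S (mapMaybe f xs)
  mapMaybe-AllPairs g [] = []
  mapMaybe-AllPairs g {x ∷ _} (rs ∷ rss) with f x in eq
  ... | just _  = mapMaybe-All (g eq) rs ∷ mapMaybe-AllPairs g rss
  ... | nothing = mapMaybe-AllPairs g rss

sum-map-mono : ∀ {A : Set} {f g : A → ℕ} → (∀ x → f x ≤ g x) → ∀ xs → sum (map f xs) ≤ sum (map g xs)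
sum-map-mono f≤g []       = z≤n
sum-map-mono f≤g (x ∷ xs) = +-mono-≤ (f≤g x) (sum-map-mono f≤g xs)

length-cartesianProduct : ∀ {A B : Set} (xs : List A) (ys : List B) → length (cartesianProduct xs ys) ≡ length xs * length ys
length-cartesianProduct []       ys = refl
length-cartesianProduct (x ∷ xs) ys =
  trans (length-++ (map (x ,_) ys)) (cong₂ _+_ (length-map (x ,_) ys) (length-cartesianProduct xs ys))

-- Reduces the total cost over a square of keys to one-dimensional sums, since the cost is additive
-- in the two coordinates.
sum-cartesianProduct : ∀ {A B : Set} c (f : A → ℕ) (g : B → ℕ) xs ys →
  sum (map (λ (x , y) → c * (f x + g y)) (cartesianProduct xs ys)) ≡
  c * (length ys * sum (map f xs) + length xs * sum (map g ys))
sum-cartesianProduct c f g [] ys = identity c (length ys)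
  where
  identity : ∀ c l → 0 ≡ c * (l * 0 + 0)
  identity = solve-∀
sum-cartesianProduct {A} {B} c f g (x ∷ xs) ys = begin
  sum (map h (map (x ,_) ys ++ cartesianProduct xs ys))
    ≡⟨ cong sum (map-++ h (map (x ,_) ys) _) ⟩
  sum (map h (map (x ,_) ys) ++ map h (cartesianProduct xs ys))
    ≡⟨ sum-++ (map h (map (x ,_) ys)) _ ⟩
  sum (map h (map (x ,_) ys)) + sum (map h (cartesianProduct xs ys))
    ≡⟨ cong₂ _+_ (fibre ys) (sum-cartesianProduct c f g xs ys) ⟩
  c * (length ys * f x + sum (map g ys)) + c * (length ys * sum (map f xs) + length xs * sum (map g ys))
    ≡⟨ identity c (length ys) (f x) (sum (map g ys)) (sum (map f xs)) (length xs) ⟩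
  c * (length ys * (f x + sum (map f xs)) + suc (length xs) * sum (map g ys)) ∎
  where
  open ≡-Reasoning
  h : A × B → ℕ
  h (x , y) = c * (f x + g y)
  identity : ∀ c l a s t k → c * (l * a + s) + c * (l * t + k * s) ≡ c * (l * (a + t) + suc k * s)
  identity = solve-∀
  identity₀ : ∀ c → 0 ≡ c * 0
  identity₀ = solve-∀
  identity₁ : ∀ c a b l s → c * (a + b) + c * (l * a + s) ≡ c * (suc l * a + (b + s))
  identity₁ = solve-∀
  fibre : ∀ ys → sum (map h (map (x ,_) ys)) ≡ c * (length ys * f x + sum (map g ys))
  fibre []       = identity₀ c
  fibre (y ∷ ys) = trans (cong (c * (f x + g y) +_) (fibre ys)) (identity₁ c (f x) (g y) (length ys) (sum (map g ys)))

-- Walks and parent relations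

module _ {V : FiniteSet} (G : Graph V) where
  open DecMembership (FiniteSet._≟_ V) using (_∈?_)

  walkLength-◅◅ : ∀ {u v w} (p : Walk G u v) (q : Walk G v w) →
                  walkLength G (p ◅◅ q) ≡ walkLength G p + walkLength G q
  walkLength-◅◅ ε       q = refl
  walkLength-◅◅ (_ ◅ p) q = cong suc (walkLength-◅◅ p q)

  source∈ : ∀ {u v} (w : Walk G u v) → u ∈ walkVertices G w
  source∈ ε       = here refl
  source∈ (_ ◅ _) = here refl

  target∈ : ∀ {u v} (w : Walk G u v) → v ∈ walkVertices G w
  target∈ ε       = here refl
  target∈ (_ ◅ w) = there (target∈ w)

  suffix : ∀ {u v x} (p : Path G u v) → x ∈ walkVertices G (Path.walk p) →
           Σ (Path G x v) λ q → pathLength q ≤ pathLength p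
  suffix record { walk = ε ; simple = s } (here refl) = record { walk = ε ; simple = s } , z≤n
  suffix record { walk = a ◅ w ; simple = s } (here refl) = record { walk = a ◅ w ; simple = s } , ≤-refl
  suffix record { walk = a ◅ w ; simple = _ ∷ s } (there x∈w)
    with q , q≤ ← suffix record { walk = w ; simple = s } x∈w = q , m≤n⇒m≤1+n q≤

  -- Supplies the simple paths that `Connected` demands, with the length bound preserved: if the new
  -- first vertex already occurs on the erased rest, the suffix starting there replaces the whole
  -- walk.
  loopErase : ∀ {u v} (w : Walk G u v) → Σ (Path G u v) λ p → pathLength p ≤ walkLength G w
  loopErase ε = record { walk = ε ; simple = [] ∷ [] } , z≤n
  loopErase {u} (a ◅ w) with loopErase w
  ... | p , p≤ with u ∈? walkVertices G (Path.walk p)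
  ...   | no u∉p = record { walk = a ◅ Path.walk p ; simple = ∉⇒All≢ u∉p ∷ Path.simple p } , s≤s p≤
  ...   | yes u∈p with q , q≤ ← suffix p u∈p = q , m≤n⇒m≤1+n (≤-trans q≤ p≤)

-- A rooted forest given by its parent relation; `rank` measures the distance to the root up to a
-- constant. Connectedness is left to the instance.
module ParentGraph {V : FiniteSet} (_⟶_ : Carrier V → Carrier V → Set)
  (_⟶?_ : ∀ u v → Dec (u ⟶ v))
  (deterministic : ∀ {u v w} → u ⟶ v → u ⟶ w → v ≡ w)
  (rank : Carrier V → ℕ) (rank-⟶ : ∀ {u v} → u ⟶ v → rank u ≡ suc (rank v)) where

  parent-< : ∀ {u v} → u ⟶ v → rank v < rank u
  parent-< s = ≤-reflexive (sym (rank-⟶ s))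

  graph : Graph V
  graph = record
    { Adj        = λ u v → u ⟶ v ⊎ v ⟶ u
    ; Adj?       = λ u v → (u ⟶? v) ⊎-dec (v ⟶? u)
    ; Adj-sym    = Sum.swap
    ; Adj-irrefl = [ <-irrefl refl ∘ parent-< , <-irrefl refl ∘ parent-< ]
    }

  -- A simple walk that has once moved away from the root can never turn back.
  descending : ∀ {p u v} (w : Walk graph u v) → Unique (walkVertices graph w) →
               u ⟶ p → p ∉ walkVertices graph w → rank u + walkLength graph w ≤ rank v
  descending ε _ _ _ = ≤-reflexive (+-identityʳ _)
  descending (inj₁ u⟶x ◅ w) _ u⟶p p∉w =
    contradiction (there (subst (_∈ _) (deterministic u⟶x u⟶p) (source∈ graph w))) p∉w
  descending {u = u} {v} (inj₂ x⟶u ◅ w) (u∉w ∷ s) _ _ =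
    subst (_≤ rank v) (trans (cong (_+ walkLength graph w) (rank-⟶ x⟶u)) (sym (+-suc (rank u) _)))
      (descending w s x⟶u (All≢⇒∉ u∉w))

  -- Dually, a simple walk whose end still has an unvisited parent moved towards the root at every step.
  ascending : ∀ {q u v} (w : Walk graph u v) → Unique (walkVertices graph w) →
              v ⟶ q → q ∉ walkVertices graph w → rank v ≤ rank u × ∃ λ x → u ⟶ x × x ∈ q ∷ walkVertices graph w
  ascending ε _ v⟶q _ = ≤-refl , _ , v⟶q , here refl
  ascending (inj₁ u⟶x ◅ w) (_ ∷ s) v⟶q q∉w =
    ≤-trans (proj₁ (ascending w s v⟶q (q∉w ∘ there))) (<⇒≤ (parent-< u⟶x)) ,
    _ , u⟶x , there (there (source∈ graph w))
  ascending (inj₂ x⟶u ◅ w) (u∉w ∷ s) v⟶q q∉w with ascending w s v⟶q (q∉w ∘ there)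
  ... | _ , y , x⟶y , y∈ with deterministic x⟶u x⟶y | y∈
  ...   | refl | here refl = contradiction (here refl) q∉w
  ...   | refl | there u∈w = contradiction u∈w (All≢⇒∉ u∉w)

  -- Split on the first step `s` to `x` of the cycle. If it leads to the parent, a closing edge to
  -- the parent of `s` would revisit `x`, and one from a child `t` gives rank t ≤ rank x < rank s <
  -- rank t by `ascending`. If it leads to a child, `descending` puts the last vertex at rank above
  -- `x`, too high to be a neighbour of `s`.
  acyclic : Acyclic graph
  acyclic record { path = record { walk = ε } ; long = () }
  acyclic record { path = record { walk = _ ◅ ε } ; long = s≤s () }
  acyclic record { path = record { walk = inj₁ s⟶x ◅ a ◅ w ; simple = _ ∷ x∉w ∷ _ } ; closing = inj₂ s⟶t }
    with refl ← deterministic s⟶x s⟶t = All≢⇒∉ x∉w (target∈ graph w)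
  acyclic record { path = record { walk = inj₁ s⟶x ◅ w@(_ ◅ _) ; simple = s∉w ∷ u } ; closing = inj₁ t⟶s } =
    <-irrefl refl (<-trans (<-≤-trans (parent-< t⟶s) (proj₁ (ascending w u t⟶s (All≢⇒∉ s∉w)))) (parent-< s⟶x))
  acyclic record { path = record { walk = inj₂ x⟶s ◅ w@(_ ◅ _) ; simple = s∉w ∷ u } ; closing = c } =
    m+1+n≰m _ (≤-trans (descending w u x⟶s (All≢⇒∉ s∉w)) (near c x⟶s))
    where
    near : ∀ {s t x} → t ⟶ s ⊎ s ⟶ t → x ⟶ s → rank t ≤ rank x
    near (inj₁ t⟶s) x⟶s = ≤-reflexive (trans (rank-⟶ t⟶s) (sym (rank-⟶ x⟶s)))
    near (inj₂ s⟶t) x⟶s = <⇒≤ (<-trans (parent-< s⟶t) (parent-< x⟶s))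

-- Enumeration of the non-tree edges

module _ {V : FiniteSet} {G : Graph V} (T : SpanningTree G) where
  open SpanningTree T using (tree)

  ends : NonTreeEdge T → Carrier V × Carrier V
  ends e = NonTreeEdge.end₁ e , NonTreeEdge.end₂ e

  nonTreeEdge?-ends : ∀ {p e} → nonTreeEdge? T p ≡ just e → ends e ≡ p
  nonTreeEdge?-ends {u , v} eq with Adj? G u v | Adj? tree u v | eq
  ... | yes _ | no _  | refl = refl
  ... | yes _ | yes _ | ()
  ... | no _  | _     | ()

  nonTreeEdge?-just : ∀ {u v} → Adj G u v → ¬ Adj tree u v → ∃ λ e → nonTreeEdge? T (u , v) ≡ just e
  nonTreeEdge?-just {u} {v} a na with Adj? G u v | Adj? tree u v
  ... | yes _  | no _  = _ , refl
  ... | yes _  | yes t = contradiction t na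
  ... | no ¬a  | _     = contradiction a ¬a

  nonTreeEdges-distinct : AllPairs (λ e e′ → ¬ SamePair (ends e) (ends e′)) (nonTreeEdges T)
  nonTreeEdges-distinct = mapMaybe-AllPairs (nonTreeEdge? T)
    (λ eq eq′ → subst₂ (λ p q → ¬ SamePair p q) (sym (nonTreeEdge?-ends eq)) (sym (nonTreeEdge?-ends eq′)))
    (unorderedPairs-distinct (FiniteSet.unique V))

  nonTreeEdges-complete : ∀ {u v} → Adj G u v → ¬ Adj tree u v →
                          ∃ λ e → e ∈ nonTreeEdges T × SamePair (ends e) (u , v)
  nonTreeEdges-complete {u} {v} a na
    with unorderedPairs-complete (λ { refl → Adj-irrefl G a }) (FiniteSet.complete V u) (FiniteSet.complete V v)
  ... | inj₁ p∈ with e , eq ← nonTreeEdge?-just a na =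
    e , mapMaybe-∈⁺ (nonTreeEdge? T) eq p∈ , inj₁ (nonTreeEdge?-ends eq)
  ... | inj₂ p∈ with e , eq ← nonTreeEdge?-just (Adj-sym G a) (na ∘ Adj-sym tree) =
    e , mapMaybe-∈⁺ (nonTreeEdge? T) eq p∈ , inj₂ (nonTreeEdge?-ends eq)

-- The dyadic tree

parity : ∀ n → (∃ λ h → n ≡ 2 * h) ⊎ (∃ λ h → n ≡ suc (2 * h))
parity zero = inj₁ (0 , refl)
parity (suc n) with parity n
... | inj₁ (h , refl) = inj₂ (h , refl)
... | inj₂ (h , refl) = inj₁ (suc h , sym (*-suc 2 h))

half-bound : ∀ h {f} → 2 * h ≤ suc f → h ≤ f
half-bound zero    _       = z≤n
half-bound (suc h) (s≤s p) = ≤-trans (≤-trans (m≤n+m (suc h) h) (≤-reflexive (cong (h +_) (cong suc (sym (+-identityʳ h)))))) p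

-- Induction on the 2-adic valuation. Halving is not structural, so `go` carries the fuel `f`.
binary-induction : (P : ℕ → Set) → (∀ h → P (suc (2 * h))) → (∀ h → P (suc h) → P (2 * suc h)) → ∀ n → P (suc n)
binary-induction P base step n = go (suc n) n ≤-refl
  where
  go : ∀ f n → n < f → P (suc n)
  go (suc f) n n<f with parity (suc n)
  ... | inj₂ (h , refl)   = base h
  ... | inj₁ (suc h , eq) = subst P (sym eq) (step h (go f h (half-bound (suc h) (subst (_≤ suc f) eq n<f))))

-- The first argument is fuel for the halvings; every value of it that is at least `n` gives the
-- same result.
lowWithin : ℕ → ℕ → ℕ
lowWithin zero    _ = 0
lowWithin (suc f) n with parity n
... | inj₁ (h , _) = 2 * lowWithin f h
... | inj₂ _       = 1

-- The largest power of 2 dividing n, with low 0 = 0: then low n ∣ m iff ν(n) ≤ ν(m), also for m = 0 or n = 0.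
low : ℕ → ℕ
low n = lowWithin n n

lowWithin-irrelevant : ∀ f g n → n ≤ f → n ≤ g → lowWithin f n ≡ lowWithin g n
lowWithin-irrelevant zero    zero    n n≤f n≤g = refl
lowWithin-irrelevant zero    (suc g) zero _ _ = cong (2 *_) (lowWithin-irrelevant 0 g 0 z≤n z≤n)
lowWithin-irrelevant (suc f) zero    zero _ _ = cong (2 *_) (lowWithin-irrelevant f 0 0 z≤n z≤n)
lowWithin-irrelevant (suc f) (suc g) n n≤f n≤g with parity n
... | inj₁ (h , refl) = cong (2 *_) (lowWithin-irrelevant f g h (half-bound h n≤f) (half-bound h n≤g))
... | inj₂ _          = refl

low-double : ∀ n → low (2 * n) ≡ 2 * low n
low-double n = trans (lowWithin-irrelevant (2 * n) (suc (2 * n)) (2 * n) ≤-refl (n≤1+n _)) step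
  where
  step : lowWithin (suc (2 * n)) (2 * n) ≡ 2 * low n
  step with parity (2 * n)
  ... | inj₁ (h , eq) rewrite *-cancelˡ-≡ n h 2 eq =
    cong (2 *_) (lowWithin-irrelevant (2 * h) h h (m≤m+n h _) ≤-refl)
  ... | inj₂ (h , eq) = contradiction eq (even≢odd n h)

low-odd : ∀ n → low (suc (2 * n)) ≡ 1
low-odd n with parity (suc (2 * n))
... | inj₁ (h , eq) = contradiction (sym eq) (even≢odd h n)
... | inj₂ _        = refl

-- Sums of largest powers of 2

lowSum : ℕ → ℕ
lowSum m = sum (map (low ∘ suc) (downFrom m))

-- Among 1, ..., 2h the odd numbers contribute 1 each, and the even ones twice the sum over 1, ...,
-- h.
lowSum-double : ∀ h → lowSum (2 * h) ≡ h + 2 * lowSum h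
lowSum-double zero    = refl
lowSum-double (suc h) = begin
  lowSum (2 * suc h)                                     ≡⟨ cong lowSum (*-suc 2 h) ⟩
  low (2 + 2 * h) + (low (1 + 2 * h) + lowSum (2 * h))   ≡⟨ cong₂ _+_ (trans (cong low (sym (*-suc 2 h))) (low-double (suc h)))
                                                              (cong₂ _+_ (low-odd h) (lowSum-double h)) ⟩
  2 * low (suc h) + (1 + (h + 2 * lowSum h))             ≡⟨ identity (low (suc h)) h (lowSum h) ⟩
  suc h + 2 * lowSum (suc h)                             ∎
  where
  open ≡-Reasoning
  identity : ∀ a h s → 2 * a + (1 + (h + 2 * s)) ≡ suc h + 2 * (a + s)
  identity = solve-∀

-- Repeated halving brings `m` to 0 within `k` rounds, and each round contributes at most `m`.
lowSum-≤ : ∀ k m → m < 2 ^ k → lowSum m ≤ m * k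
lowSum-≤ zero    zero _ = z≤n
lowSum-≤ zero    (suc m) (s≤s ())
lowSum-≤ (suc k) m m<2^k with parity m
... | inj₁ (h , refl) = begin
  lowSum (2 * h)             ≡⟨ lowSum-double h ⟩
  h + 2 * lowSum h           ≤⟨ +-mono-≤ (m≤m+n h h) (*-monoʳ-≤ 2 (lowSum-≤ k h (*-cancelˡ-< 2 h _ m<2^k))) ⟩
  (h + h) + 2 * (h * k)      ≡⟨ identity h k ⟩
  2 * h * suc k              ∎
  where
  open ≤-Reasoning
  identity : ∀ h k → (h + h) + 2 * (h * k) ≡ 2 * h * suc k
  identity = solve-∀
... | inj₂ (h , refl) = begin
  low (suc (2 * h)) + lowSum (2 * h) ≡⟨ cong₂ _+_ (low-odd h) (lowSum-double h) ⟩
  1 + (h + 2 * lowSum h)             ≤⟨ +-monoʳ-≤ 1 (+-mono-≤ (m≤m+n h (h + k)) (*-monoʳ-≤ 2 (lowSum-≤ k h (*-cancelˡ-< 2 h _ (<-trans (n<1+n _) m<2^k))))) ⟩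
  1 + ((h + (h + k)) + 2 * (h * k))        ≡⟨ identity h k ⟩
  suc (2 * h) * suc k                ∎
  where
  open ≤-Reasoning
  identity : ∀ h k → 1 + ((h + (h + k)) + 2 * (h * k)) ≡ suc (2 * h) * suc k
  identity = solve-∀

-- The parent relation and its self-similarity

Point : Set
Point = ℕ × ℕ

infix 4 _⟶_ _⟶*_

-- The two conditions are complementary, so every point except the origin has exactly one parent. On
-- the axes `low 0 = 0` settles the choice: 0 divides no positive number, and everything divides 0.
data _⟶_ : Point → Point → Set where
  row : ∀ {i j} → low (suc j) ∣ i → (i , suc j) ⟶ (i , j)
  col : ∀ {i j} → low j ∤ suc i → (suc i , j) ⟶ (i , j)

_⟶*_ : Point → Point → Set
_⟶*_ = Star _⟶_

norm : Point → ℕ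
norm (i , j) = i + j

_⟶?_ : ∀ p q → Dec (p ⟶ q)
(i , j) ⟶? (i′ , j′) = map′
  (λ { (inj₁ (refl , refl , d)) → row d ; (inj₂ (refl , refl , ¬d)) → col ¬d })
  (λ { (row d) → inj₁ (refl , refl , d) ; (col ¬d) → inj₂ (refl , refl , ¬d) })
  ((i ≟ i′ ×-dec j ≟ suc j′ ×-dec low j ∣? i) ⊎-dec (i ≟ suc i′ ×-dec j ≟ j′ ×-dec ¬? (low j ∣? i)))

⟶-deterministic : ∀ {p q r} → p ⟶ q → p ⟶ r → q ≡ r
⟶-deterministic (row _)  (row _)  = refl
⟶-deterministic (row d)  (col ¬d) = contradiction d ¬d
⟶-deterministic (col ¬d) (row d)  = contradiction d ¬d
⟶-deterministic (col _)  (col _)  = refl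

⟶-norm : ∀ {p q} → p ⟶ q → norm p ≡ suc (norm q)
⟶-norm (row {i} {j} _) = +-suc i j
⟶-norm (col _)         = refl

descend : ∀ i j → (i , j) ⟶* (0 , 0)
descend zero    zero    = ε
descend (suc i) zero    = col (λ d → 1+n≢0 (0∣⇒≡0 d)) ◅ descend i zero
descend zero    (suc j) = row (_ ∣0) ◅ descend zero j
descend (suc i) (suc j) with low (suc j) ∣? suc i
... | yes d = row d ◅ descend (suc i) j
... | no ¬d = col ¬d ◅ descend i (suc j)

double : Point → Point
double (i , j) = 2 * i , 2 * j

row-odd : ∀ i j → (i , suc (2 * j)) ⟶ (i , 2 * j)
row-odd i j = row (subst (_∣ i) (sym (low-odd j)) (1∣ i))

col-odd : ∀ i j → (suc (2 * i) , 2 * j) ⟶ (2 * i , 2 * j)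
col-odd i j = col λ d → 2∤odd (m*n∣⇒m∣ 2 (low j) (subst (_∣ suc (2 * i)) (low-double j) d))
  where
  2∤odd : 2 ∤ suc (2 * i)
  2∤odd (divides q eq) = even≢odd q i (trans (*-comm 2 q) (sym eq))

-- The divisibility test is invariant under scaling by 2, so the first step has the same direction.
-- It makes one coordinate odd, and there `row-odd` or `col-odd` forces the second step to continue
-- straight on.
⟶-double : ∀ {p q} → p ⟶ q → double p ⟶* double q
⟶-double (row {i} {j} d) =
  subst (λ k → (2 * i , k) ⟶* (2 * i , 2 * j)) (sym (*-suc 2 j))
    (row (subst (_∣ 2 * i) (sym (trans (cong low (sym (*-suc 2 j))) (low-double (suc j)))) (*-monoʳ-∣ 2 d))
      ◅ row-odd (2 * i) j ◅ ε)
⟶-double (col {i} {j} ¬d) =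
  subst (λ k → (k , 2 * j) ⟶* (2 * i , 2 * j)) (sym (*-suc 2 i))
    (col (λ d → ¬d (*-cancelˡ-∣ 2 (subst₂ _∣_ (low-double j) (sym (*-suc 2 i)) d)))
      ◅ col-odd i j ◅ ε)

⟶*-double : ∀ {p q} → p ⟶* q → double p ⟶* double q
⟶*-double = kleisliStar double ⟶-double

-- Blocks and meeting points of neighbours

data Half : ℕ → ℕ → Set where
  even : ∀ h → Half (2 * h) h
  odd  : ∀ h → Half (suc (2 * h)) h

half : ∀ n → ∃ (Half n)
half n with parity n
... | inj₁ (h , refl) = h , even h
... | inj₂ (h , refl) = h , odd h

-- The target is the lower left vertex of the 2 × 2 block containing the point. From the opposite
-- vertex the `row` step comes first, because `low` of an odd number is 1.
to-corner : ∀ {i j a b} → Half i a → Half j b → (i , j) ⟶* (2 * a , 2 * b)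
to-corner (even a) (even b) = ε
to-corner (even a) (odd b)  = row-odd _ b ◅ ε
to-corner (odd a)  (even b) = col-odd a b ◅ ε
to-corner (odd a)  (odd b)  = row-odd _ b ◅ col-odd a b ◅ ε

half-≤ : ∀ {n h} → Half n h → n ≤ suc (2 * h)
half-≤ (even h) = n≤1+n _
half-≤ (odd h)  = ≤-refl

-- Each step lowers `norm` by one, so the two inequalities say that both descents to `apex` have
-- length at most `r`.
record Meet (r : ℕ) (p q : Point) : Set where
  field
    {apex} : Point
    left   : p ⟶* apex
    right  : q ⟶* apex
    left-≤  : norm p ≤ norm apex + r
    right-≤ : norm q ≤ norm apex + r

meet-refl : ∀ p → Meet 0 p p
meet-refl p = record { left = ε ; right = ε ; left-≤ = m≤m+n _ 0 ; right-≤ = m≤m+n _ 0 }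

meet-sym : ∀ {r p q} → Meet r p q → Meet r q p
meet-sym m = record { left = right ; right = left ; left-≤ = right-≤ ; right-≤ = left-≤ }
  where open Meet m

-- At most two steps lead to the corner of the 2 × 2 block; from there the descents of the halves
-- are followed at double scale.
meet-double : ∀ {r i j i′ j′ a b a′ b′} → Half i a → Half j b → Half i′ a′ → Half j′ b′ →
              Meet r (a , b) (a′ , b′) → Meet (2 * r + 2) (i , j) (i′ , j′)
meet-double {r} {i} {j} {i′} {j′} {a} {b} {a′} {b′} ha hb ha′ hb′ m = record
  { left    = to-corner ha hb ◅◅ ⟶*-double left
  ; right   = to-corner ha′ hb′ ◅◅ ⟶*-double right
  ; left-≤  = bound ha hb left-≤
  ; right-≤ = bound ha′ hb′ right-≤
  }
  where
  open Meet m
  open ≤-Reasoning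
  x = proj₁ apex
  y = proj₂ apex
  identity₁ : ∀ a b → suc (2 * a) + suc (2 * b) ≡ 2 * (a + b) + 2
  identity₁ = solve-∀
  identity₂ : ∀ x y r → 2 * (x + y + r) + 2 ≡ 2 * x + 2 * y + (2 * r + 2)
  identity₂ = solve-∀
  bound : ∀ {i j a b} → Half i a → Half j b → a + b ≤ norm apex + r → i + j ≤ norm (double apex) + (2 * r + 2)
  bound {i} {j} {a} {b} ha hb le = begin
    i + j                             ≤⟨ +-mono-≤ (half-≤ ha) (half-≤ hb) ⟩
    suc (2 * a) + suc (2 * b)         ≡⟨ identity₁ a b ⟩
    2 * (a + b) + 2                   ≤⟨ +-monoˡ-≤ 2 (*-monoʳ-≤ 2 le) ⟩
    2 * (x + y + r) + 2               ≡⟨ identity₂ x y r ⟩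
    2 * x + 2 * y + (2 * r + 2)       ∎

-- The offset 2 makes the bound stable under r ↦ 2r + 2, since (2r + 2) + 2 = 2 (r + 2). The
-- recursion starts at radius 2 with `low` equal to 1, where equality holds.
double-radius : ∀ r h → r + 2 ≤ 4 * low h → (2 * r + 2) + 2 ≤ 4 * low (2 * h)
double-radius r h le = begin
  (2 * r + 2) + 2   ≡⟨ identity₁ r ⟩
  2 * (r + 2)       ≤⟨ *-monoʳ-≤ 2 le ⟩
  2 * (4 * low h)   ≡⟨ identity₂ (low h) ⟩
  4 * (2 * low h)   ≡⟨ cong (4 *_) (low-double h) ⟨
  4 * low (2 * h)   ∎
  where
  open ≤-Reasoning
  identity₁ : ∀ r → (2 * r + 2) + 2 ≡ 2 * (r + 2)
  identity₁ = solve-∀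
  identity₂ : ∀ l → 2 * (4 * l) ≡ 4 * (2 * l)
  identity₂ = solve-∀

-- If `suc j` is odd, both points lie in one 2 × 2 block and meet in its corner. If `suc j` is 2 (h
-- + 1), then `j` is 2h + 1, so the halves are again neighbours, at `suc h` and `h`, and their
-- meeting is doubled.
meet-row : ∀ j i → ∃ λ r → r + 2 ≤ 4 * low (suc j) × Meet r (i , suc j) (i , j)
meet-row j = binary-induction P base step j j refl
  where
  P : ℕ → Set
  P k = ∀ j → k ≡ suc j → ∀ i → ∃ λ r → r + 2 ≤ 4 * low k × Meet r (i , k) (i , j)
  base : ∀ h → P (suc (2 * h))
  base h j refl i with half i
  ... | a , ha = 2 , ≤-reflexive (sym (cong (4 *_) (low-odd h))) , meet-double ha (odd h) ha (even h) (meet-refl (a , h))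
  step : ∀ h → P (suc h) → P (2 * suc h)
  step h ih j eq i with half i | suc-injective (trans (sym (*-suc 2 h)) eq)
  ... | a , ha | refl with ih h refl a
  ... | r , r≤ , m = 2 * r + 2 , double-radius r (suc h) r≤
                   , meet-double ha (even (suc h)) ha (odd h) m

meet-col : ∀ i j → ∃ λ r → r + 2 ≤ 4 * low (suc i) × Meet r (suc i , j) (i , j)
meet-col i = binary-induction P base step i i refl
  where
  P : ℕ → Set
  P k = ∀ i → k ≡ suc i → ∀ j → ∃ λ r → r + 2 ≤ 4 * low k × Meet r (k , j) (i , j)
  base : ∀ h → P (suc (2 * h))
  base h i refl j with half j
  ... | b , hb = 2 , ≤-reflexive (sym (cong (4 *_) (low-odd h))) , meet-double (odd h) hb (even h) hb (meet-refl (h , b))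
  step : ∀ h → P (suc h) → P (2 * suc h)
  step h ih i eq j with half j | suc-injective (trans (sym (*-suc 2 h)) eq)
  ... | b , hb | refl with ih h refl b
  ... | r , r≤ , m = 2 * r + 2 , double-radius r (suc h) r≤
                   , meet-double (even (suc h)) hb (odd h) hb m

-- The edges outside the tree

-- The edge from (suc i , suc j) to the one of its two predecessors that is not its parent.
data Missing : ℕ → ℕ → Point → Point → Set where
  vertical   : ∀ {i j} → low (suc j) ∣ suc i → Missing i j (suc i , suc j) (i , suc j)
  horizontal : ∀ {i j} → low (suc j) ∤ suc i → Missing i j (suc i , suc j) (suc i , j)

missing : ∀ i j → ∃ λ q → Missing i j (suc i , suc j) q
missing i j with low (suc j) ∣? suc i
... | yes d = _ , vertical d
... | no ¬d = _ , horizontal ¬d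

missing-deterministic : ∀ {i j p q p′ q′} → Missing i j p q → Missing i j p′ q′ → p ≡ p′ × q ≡ q′
missing-deterministic (vertical _)    (vertical _)    = refl , refl
missing-deterministic (vertical d)    (horizontal ¬d) = contradiction d ¬d
missing-deterministic (horizontal ¬d) (vertical d)    = contradiction d ¬d
missing-deterministic (horizontal _)  (horizontal _)  = refl , refl

missing-up : ∀ {i j p q} → Missing i j p q → ¬ (p ⟶ q)
missing-up (vertical d)    (col ¬d) = ¬d d
missing-up (horizontal ¬d) (row d)  = ¬d d

missing-down : ∀ {i j p q} → Missing i j p q → ¬ (q ⟶ p)
missing-down (vertical _)   ()
missing-down (horizontal _) ()

missing-injective : ∀ {i j i′ j′ p q} → Missing i j p q → Missing i′ j′ p q → i ≡ i′ × j ≡ j′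
missing-injective (vertical _)   (vertical _)   = refl , refl
missing-injective (horizontal _) (horizontal _) = refl , refl

missing-asym : ∀ {i j i′ j′ p q} → Missing i j p q → ¬ Missing i′ j′ q p
missing-asym (vertical _)   ()
missing-asym (horizontal _) ()

missing-meet : ∀ {i j p q} → Missing i j p q → ∃ λ r → r + 2 ≤ 4 * (low (suc i) + low (suc j)) × Meet r p q
missing-meet (vertical {i} {j} _) with meet-col i (suc j)
... | r , r≤ , m = r , ≤-trans r≤ (*-monoʳ-≤ 4 (m≤m+n (low (suc i)) _)) , m
missing-meet (horizontal {i} {j} _) with meet-row j (suc i)
... | r , r≤ , m = r , ≤-trans r≤ (*-monoʳ-≤ 4 (m≤n+m _ (low (suc i)))) , m

-- Edges on the coordinate axes are tree edges, so the upper end of a non-tree edge has two positive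
-- coordinates and owns that edge.
missing-row : ∀ i j → ¬ ((i , suc j) ⟶ (i , j)) → ∃ λ i′ → Missing i′ j (i , suc j) (i , j)
missing-row zero    j ¬s = contradiction (row (_ ∣0)) ¬s
missing-row (suc i) j ¬s = i , horizontal λ d → ¬s (row d)

missing-col : ∀ i j → ¬ ((suc i , j) ⟶ (i , j)) → ∃ λ j′ → Missing i j′ (suc i , j) (i , j)
missing-col i zero    ¬s = contradiction (col λ d → 1+n≢0 (0∣⇒≡0 d)) ¬s
missing-col i (suc j) ¬s with low (suc j) ∣? suc i
... | yes d = j , vertical d
... | no ¬d = contradiction (col ¬d) ¬s

-- The spanning tree of the n-grid

MissingPair : ℕ → ℕ → Point → Point → Set
MissingPair i j p q = Missing i j p q ⊎ Missing i j q p

missingPair-injective : ∀ {i j i′ j′ p q} → MissingPair i j p q → MissingPair i′ j′ p q → (i , j) ≡ (i′ , j′)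
missingPair-injective (inj₁ x) (inj₁ y) with refl , refl ← missing-injective x y = refl
missingPair-injective (inj₁ x) (inj₂ y) = contradiction y (missing-asym x)
missingPair-injective (inj₂ x) (inj₁ y) = contradiction x (missing-asym y)
missingPair-injective (inj₂ x) (inj₂ y) with refl , refl ← missing-injective x y = refl

missingPair-meet : ∀ {i j p q} → MissingPair i j p q → ∃ λ r → r + 2 ≤ 4 * (low (suc i) + low (suc j)) × Meet r p q
missingPair-meet (inj₁ x) = missing-meet x
missingPair-meet (inj₂ x) with r , r≤ , m ← missing-meet x = r , r≤ , meet-sym m

-- Two descents of length at most `r` and the edge make a closed walk of length at most 2r + 1 ≤ 2
-- (r + 2), and r + 2 is at most 4 times the sum of the `low` values. Using both values makes the
-- bound independent of the direction of the edge.
cost : Point → ℕ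
cost (i , j) = 8 * (low (suc i) + low (suc j))

module GridTree (n : ℕ) where

  Vertex : Set
  Vertex = Fin n × Fin n

  pos : Vertex → Point
  pos (a , b) = toℕ a , toℕ b

  pos-injective : ∀ {u v} → pos u ≡ pos v → u ≡ v
  pos-injective eq = cong₂ _,_ (toℕ-injective (cong proj₁ eq)) (toℕ-injective (cong proj₂ eq))

  vertex : ∀ {i j} → i < n → j < n → ∃ λ u → pos u ≡ (i , j)
  vertex i<n j<n = (fromℕ< i<n , fromℕ< j<n) , cong₂ _,_ (toℕ-fromℕ< i<n) (toℕ-fromℕ< j<n)

  pos<n : ∀ u {i j} → pos u ≡ (i , j) → i < n × j < n
  pos<n (a , b) refl = toℕ<n a , toℕ<n b

  module Parent = ParentGraph {FinSet n ×ᶠ FinSet n} (λ u v → pos u ⟶ pos v) (λ u v → pos u ⟶? pos v)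
    (λ s t → pos-injective (⟶-deterministic s t)) (norm ∘ pos) ⟶-norm

  row-adj : ∀ {i j} u v → pos u ≡ (i , suc j) → pos v ≡ (i , j) → Adj (grid n) u v
  row-adj u v pu pv = inj₂ (toℕ-injective (trans (cong proj₁ pu) (sym (cong proj₁ pv))) ,
                            inj₂ (trans (cong proj₂ pu) (cong suc (sym (cong proj₂ pv)))))

  col-adj : ∀ {i j} u v → pos u ≡ (suc i , j) → pos v ≡ (i , j) → Adj (grid n) u v
  col-adj u v pu pv = inj₁ (inj₂ (trans (cong proj₁ pu) (cong suc (sym (cong proj₁ pv)))) ,
                            toℕ-injective (trans (cong proj₂ pu) (sym (cong proj₂ pv))))

  ⟶-adj : ∀ {p q} u v → p ⟶ q → pos u ≡ p → pos v ≡ q → Adj (grid n) u v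
  ⟶-adj u v (row _) pu pv = row-adj u v pu pv
  ⟶-adj u v (col _) pu pv = col-adj u v pu pv

  missing-adj : ∀ {i j p q} u v → Missing i j p q → pos u ≡ p → pos v ≡ q → Adj (grid n) u v
  missing-adj u v (vertical _)   pu pv = col-adj u v pu pv
  missing-adj u v (horizontal _) pu pv = row-adj u v pu pv

  missing-vertices : ∀ {i j p q} → Missing i j p q → suc i < n → suc j < n → ∃₂ λ u v → pos u ≡ p × pos v ≡ q
  missing-vertices (vertical _) i<n j<n
    with u , pu ← vertex i<n j<n | v , pv ← vertex (<-trans (n<1+n _) i<n) j<n = u , v , pu , pv
  missing-vertices (horizontal _) i<n j<n
    with u , pu ← vertex i<n j<n | v , pv ← vertex i<n (<-trans (n<1+n _) j<n) = u , v , pu , pv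

  missing-bounded : ∀ {i j p q} u → Missing i j p q → pos u ≡ p → suc i < n × suc j < n
  missing-bounded u (vertical _)   pu = pos<n u pu
  missing-bounded u (horizontal _) pu = pos<n u pu

  missingPair-edge : ∀ {i j} u v → MissingPair i j (pos u) (pos v) → Adj (grid n) u v × ¬ Adj Parent.graph u v
  missingPair-edge u v (inj₁ m) = missing-adj u v m refl refl , [ missing-up m , missing-down m ]
  missingPair-edge u v (inj₂ m) = Adj-sym (grid n) (missing-adj v u m refl refl) , [ missing-down m , missing-up m ]

  edge-missingPair : ∀ u v → Adj (grid n) u v → ¬ Adj Parent.graph u v → ∃₂ λ i j → MissingPair i j (pos u) (pos v)
  edge-missingPair (a , b) (a′ , .b) (inj₁ (inj₁ eq , refl)) na rewrite eq
    with j , m ← missing-col (toℕ a) (toℕ b) (na ∘ inj₂) = _ , j , inj₂ m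
  edge-missingPair (a , b) (a′ , .b) (inj₁ (inj₂ eq , refl)) na rewrite eq
    with j , m ← missing-col (toℕ a′) (toℕ b) (na ∘ inj₁) = _ , j , inj₁ m
  edge-missingPair (a , b) (.a , b′) (inj₂ (refl , inj₁ eq)) na rewrite eq
    with i , m ← missing-row (toℕ a) (toℕ b) (na ∘ inj₂) = i , _ , inj₂ m
  edge-missingPair (a , b) (.a , b′) (inj₂ (refl , inj₂ eq)) na rewrite eq
    with i , m ← missing-row (toℕ a) (toℕ b′) (na ∘ inj₁) = i , _ , inj₁ m

  lift : ∀ {p q} u → pos u ≡ p → p ⟶ q → ∃ λ v → pos v ≡ q
  lift u pu (row _) with i<n , j<n ← pos<n u pu = vertex i<n (<-trans (n<1+n _) j<n)
  lift u pu (col _) with i<n , j<n ← pos<n u pu = vertex (<-trans (n<1+n _) i<n) j<n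

  -- Follows the first descent and then the second one backwards; by `lift` all intermediate points
  -- stay in the grid. The length is the total drop of `norm`, stated additively to avoid
  -- subtraction.
  connect : ∀ {p p′ q} → p ⟶* q → p′ ⟶* q → ∀ u v → pos u ≡ p → pos v ≡ p′ →
            Σ (Walk Parent.graph u v) λ w → walkLength Parent.graph w + (norm q + norm q) ≡ norm p + norm p′
  connect ε ε u v pu pv with refl ← pos-injective {u} {v} (trans pu (sym pv)) = ε , refl
  connect {p} {p′} {q} (s ◅ ss) t u v pu pv with lift u pu s
  ... | u′ , pu′ with w , eq ← connect ss t u′ v pu′ pv =
    inj₁ (subst₂ _⟶_ (sym pu) (sym pu′) s) ◅ w , trans (cong suc eq) (cong (_+ norm p′) (sym (⟶-norm s)))
  connect {p} {p′} {q} ε (_◅_ {j = r} t ts) u v pu pv with lift v pv t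
  ... | v′ , pv′ with w , eq ← connect ε ts u v′ pu pv′ =
    w ◅◅ (inj₂ (subst₂ _⟶_ (sym pv) (sym pv′) t) ◅ ε) ,
    (begin
      walkLength Parent.graph (w ◅◅ (_ ◅ ε)) + (norm q + norm q)  ≡⟨ cong (_+ (norm q + norm q)) (walkLength-◅◅ Parent.graph w _) ⟩
      (walkLength Parent.graph w + 1) + (norm q + norm q)         ≡⟨ cong (_+ (norm q + norm q)) (+-comm (walkLength Parent.graph w) 1) ⟩
      suc (walkLength Parent.graph w + (norm q + norm q))         ≡⟨ cong suc eq ⟩
      suc (norm q + norm r)                                       ≡⟨ +-suc (norm q) (norm r) ⟨
      norm q + suc (norm r)                                       ≡⟨ cong (norm q +_) (⟶-norm t) ⟨
      norm q + norm p′                                            ∎)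
    where open ≡-Reasoning

  meet-walk : ∀ {r} u v → Meet r (pos u) (pos v) → Σ (Walk Parent.graph u v) λ w → walkLength Parent.graph w ≤ r + r
  meet-walk {r} u v m with w , eq ← connect (Meet.left m) (Meet.right m) u v refl refl = w , +-cancelʳ-≤ (norm apex + norm apex) _ _ (begin
      walkLength Parent.graph w + (norm apex + norm apex) ≡⟨ eq ⟩
      norm (pos u) + norm (pos v)                         ≤⟨ +-mono-≤ left-≤ right-≤ ⟩
      (norm apex + r) + (norm apex + r)                   ≡⟨ identity (norm apex) r ⟩
      (r + r) + (norm apex + norm apex)                   ∎)
    where
    open Meet m
    open ≤-Reasoning
    identity : ∀ a r → (a + r) + (a + r) ≡ (r + r) + (a + a)
    identity = solve-∀

  missingPair-walk : ∀ {i j} u v → MissingPair i j (pos u) (pos v) →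
                     Σ (Walk Parent.graph u v) λ w → suc (walkLength Parent.graph w) ≤ cost (i , j)
  missingPair-walk {i} {j} u v mp with missingPair-meet mp
  ... | r , r≤ , m with w , w≤ ← meet-walk u v m = w , (begin
      suc (walkLength Parent.graph w)              ≤⟨ s≤s w≤ ⟩
      suc (r + r)                                  ≤⟨ m≤m+n _ 3 ⟩
      suc (r + r) + 3                              ≡⟨ identity₁ r ⟩
      2 * (r + 2)                                  ≤⟨ *-monoʳ-≤ 2 r≤ ⟩
      2 * (4 * (low (suc i) + low (suc j)))        ≡⟨ *-assoc 2 4 (low (suc i) + low (suc j)) ⟨
      cost (i , j)                                 ∎)
    where
    open ≤-Reasoning
    identity₁ : ∀ r → suc (r + r) + 3 ≡ 2 * (r + 2)
    identity₁ = solve-∀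

  -- The walk that `connected` will use is chosen per pair: the short one through the meeting point
  -- for non-tree edges of the grid, one through the origin otherwise. The cycle bound then follows
  -- without comparing different tree paths.
  tree-walk : ∀ u v → Σ (Walk Parent.graph u v) λ w →
              ∀ {i j} → MissingPair i j (pos u) (pos v) → suc (walkLength Parent.graph w) ≤ cost (i , j)
  tree-walk u@(a , b) v@(a′ , b′) with Adj? (grid n) u v | Adj? Parent.graph u v
  ... | no ¬adj | _     = proj₁ (connect (descend _ _) (descend _ _) u v refl refl) ,
                          λ mp → contradiction (proj₁ (missingPair-edge u v mp)) ¬adj
  ... | yes _ | yes t   = proj₁ (connect (descend _ _) (descend _ _) u v refl refl) ,
                          λ mp → contradiction t (proj₂ (missingPair-edge u v mp))
  ... | yes adj | no ¬t with _ , _ , mp ← edge-missingPair u v adj ¬t with w , w≤ ← missingPair-walk u v mp =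
    w , λ mp′ → subst (λ p → suc (walkLength Parent.graph w) ≤ cost p) (missingPair-injective mp mp′) w≤

  spanningTree : SpanningTree (grid n)
  spanningTree = record
    { tree      = Parent.graph
    ; subgraph  = λ { {u} {v} (inj₁ s) → ⟶-adj u v s refl refl
                    ; {u} {v} (inj₂ s) → Adj-sym (grid n) (⟶-adj v u s refl refl) }
    ; connected = λ u v → proj₁ (loopErase Parent.graph (proj₁ (tree-walk u v)))
    ; acyclic   = Parent.acyclic
    }

  open SpanningTree spanningTree using (subgraph; connected)

  -- Keys and lengths of fundamental cycles

  Edge : Set
  Edge = NonTreeEdge spanningTree

  key-missing : (e : Edge) → let u , v = ends spanningTree e in ∃₂ λ i j → MissingPair i j (pos u) (pos v)
  key-missing e = edge-missingPair end₁ end₂ isEdge notInTree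
    where open NonTreeEdge e

  -- The owner of the edge shifted by (1 , 1), so that the keys fill a square with corner (0 , 0)
  -- and side n - 1.
  key : Edge → Point
  key e = let i , j , _ = key-missing e in i , j

  fundamentalCycle-≤ : ∀ e → cycleLength (fundamentalCycle spanningTree e) ≤ cost (key e)
  fundamentalCycle-≤ e with key-missing e
  ... | i , j , mp = begin
    cycleLength (fundamentalCycle spanningTree e)      ≡⟨ cong suc (walkLength-lift {H = Parent.graph} {G = grid n} subgraph (Path.walk (connected end₁ end₂))) ⟩
    suc (pathLength (connected end₁ end₂))             ≤⟨ s≤s (proj₂ (loopErase Parent.graph (proj₁ (tree-walk end₁ end₂)))) ⟩
    suc (walkLength Parent.graph (proj₁ (tree-walk end₁ end₂))) ≤⟨ proj₂ (tree-walk end₁ end₂) mp ⟩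
    cost (i , j)                                       ∎
    where
    open NonTreeEdge e
    open ≤-Reasoning

  missing-ends : ∀ {i j} u v u′ v′ → Missing i j (pos u) (pos v) → Missing i j (pos u′) (pos v′) → (u , v) ≡ (u′ , v′)
  missing-ends u v u′ v′ m m′ with pu , pv ← missing-deterministic m m′ =
    cong₂ _,_ (pos-injective pu) (pos-injective pv)

  missingPair-deterministic : ∀ {i j} u v u′ v′ → MissingPair i j (pos u) (pos v) → MissingPair i j (pos u′) (pos v′) →
                              SamePair (u , v) (u′ , v′)
  missingPair-deterministic u v u′ v′ (inj₁ m) (inj₁ m′) = inj₁ (missing-ends u v u′ v′ m m′)
  missingPair-deterministic u v u′ v′ (inj₁ m) (inj₂ m′) = inj₂ (missing-ends u v v′ u′ m m′)
  missingPair-deterministic u v u′ v′ (inj₂ m) (inj₁ m′) = inj₂ (cong Product.swap (missing-ends v u u′ v′ m m′))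
  missingPair-deterministic u v u′ v′ (inj₂ m) (inj₂ m′) = inj₁ (cong Product.swap (missing-ends v u v′ u′ m m′))

  key-injective : ∀ e e′ → key e ≡ key e′ → SamePair (ends spanningTree e) (ends spanningTree e′)
  key-injective e e′ eq with key-missing e | key-missing e′ | eq
  ... | _ , _ , mp | _ , _ , mp′ | refl = missingPair-deterministic _ _ _ _ mp mp′

  key-unique : ∀ e {i j} → MissingPair i j (pos (NonTreeEdge.end₁ e)) (pos (NonTreeEdge.end₂ e)) → key e ≡ (i , j)
  key-unique e mp with key-missing e
  ... | _ , _ , mp′ = missingPair-injective mp′ mp

  key-bounded : ∀ e → let i , j = key e in suc i < n × suc j < n
  key-bounded e with key-missing e
  ... | _ , _ , inj₁ m = missing-bounded _ m refl
  ... | _ , _ , inj₂ m = missing-bounded _ m refl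

  key-surjective : ∀ {i j} → suc i < n → suc j < n → ∃ λ e → e ∈ nonTreeEdges spanningTree × key e ≡ (i , j)
  key-surjective {i} {j} i<n j<n with missing i j
  ... | q , m with missing-vertices m i<n j<n
  ... | u , v , pu , pv with subst₂ (Missing i j) (sym pu) (sym pv) m
  ... | m′ with missingPair-edge u v (inj₁ m′)
  ... | adj , ¬t with nonTreeEdges-complete spanningTree adj ¬t
  -- The enumeration may list the edge in either orientation.
  ... | e , e∈ , inj₁ refl = e , e∈ , key-unique e (inj₁ m′)
  ... | e , e∈ , inj₂ refl = e , e∈ , key-unique e (inj₂ m′)

-- Counting the edges and comparing with the logarithm

square : ℕ → List Point
square m = cartesianProduct (downFrom m) (downFrom m)

module _ (m : ℕ) where
  open GridTree (suc m)

  -- Both lists are duplicate-free with the same elements. This yields the number of non-tree edges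
  -- and turns a sum over edges into a sum over the square.
  keys-↭ : map key (nonTreeEdges spanningTree) ↭ square m
  keys-↭ = ∼bag⇒↭ (unique∧set⇒bag
    (AllPairs.map⁺ (AllPairs.map (λ {e} {e′} ¬same eq → ¬same (key-injective e e′ eq)) (nonTreeEdges-distinct spanningTree)))
    (cartesianProduct⁺ (downFrom⁺ m) (downFrom⁺ m))
    (mk⇔ to from))
    where
    to : ∀ {p} → p ∈ map key (nonTreeEdges spanningTree) → p ∈ square m
    to p∈ with e , _ , refl ← ∈-map⁻ key p∈ with i<n , j<n ← key-bounded e =
      ∈-cartesianProduct⁺ (∈-downFrom⁺ (s≤s⁻¹ i<n)) (∈-downFrom⁺ (s≤s⁻¹ j<n))
    from : ∀ {p} → p ∈ square m → p ∈ map key (nonTreeEdges spanningTree)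
    from p∈ with i∈ , j∈ ← ∈-cartesianProduct⁻ (downFrom m) (downFrom m) p∈
      with e , e∈ , refl ← key-surjective (s≤s (∈-downFrom⁻ i∈)) (s≤s (∈-downFrom⁻ j∈)) = ∈-map⁺ key e∈

mean-≤-log : ∀ c {k n} → 2 ^ k ≤ n → ∀ xs → sum xs ≤ c * k * length xs → mean xs ≤[ c ·log₂ n ]
-- The dummy mean 0 reduces the claim to 1 ≤ n ^ (c * 1).
mean-≤-log c {k} {n} 2^k≤n [] _ = ≤-trans (≤-reflexive (sym (^-zeroˡ (c * 1)))) (^-monoˡ-≤ (c * 1) (≤-trans (m^n>0 2 k) 2^k≤n))
mean-≤-log c {k} {n} 2^k≤n xs@(_ ∷ _) sum≤ = begin
  2 ^ sum xs               ≤⟨ ^-monoʳ-≤ 2 sum≤ ⟩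
  2 ^ (c * k * length xs)  ≡⟨ cong (2 ^_) (identity c k (length xs)) ⟩
  2 ^ (k * (c * length xs)) ≡⟨ ^-*-assoc 2 k (c * length xs) ⟨
  (2 ^ k) ^ (c * length xs) ≤⟨ ^-monoˡ-≤ (c * length xs) 2^k≤n ⟩
  n ^ (c * length xs)      ∎
  where
  open ≤-Reasoning
  identity : ∀ c k l → c * k * l ≡ k * (c * l)
  identity = solve-∀

-- The exponent is the integer part of log₂ n for n = m + 2. It is written as a successor because
-- its positivity later absorbs an additive 1.
binary-scale : ∀ m → ∃ λ k → 2 ^ suc k ≤ suc (suc m) × suc (suc m) < 2 ^ suc (suc k)
binary-scale zero = 0 , ≤-refl , s≤s (s≤s (s≤s z≤n))
binary-scale (suc m) with binary-scale m
... | k , lo , hi with suc (suc (suc m)) <? 2 ^ suc (suc k)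
...   | yes lt = k , m≤n⇒m≤1+n lo , lt
...   | no ¬lt = suc k , ≮⇒≥ ¬lt , ≤-<-trans hi (^-monoʳ-< 2 (s≤s (s≤s z≤n)) (n<1+n (suc (suc k))))

corollary2 : (n : ℕ) → 2 ≤ n →
    Σ[ T ∈ SpanningTree (grid n) ] (averageFundamentalCycleLength T ≤[ 40 ·log₂ n ])
corollary2 (suc zero) (s≤s ())
corollary2 (suc (suc m′)) _ with binary-scale m′
... | k′ , 2^k≤n , n<2^1+k = spanningTree , mean-≤-log 40 {k} 2^k≤n lengths (begin
    sum lengths                                    ≤⟨ sum-map-mono fundamentalCycle-≤ edges ⟩
    sum (map (cost ∘ key) edges)                   ≡⟨ cong sum (map-∘ edges) ⟩
    sum (map cost (map key edges))                 ≡⟨ sum-↭ (↭.map⁺ cost (keys-↭ m)) ⟩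
    sum (map cost (square m))                      ≡⟨ sum-cartesianProduct 8 (low ∘ suc) (low ∘ suc) (downFrom m) (downFrom m) ⟩
    8 * (length (downFrom m) * lowSum m + length (downFrom m) * lowSum m)
                                                   ≡⟨ cong (λ l → 8 * (l * lowSum m + l * lowSum m)) (length-downFrom m) ⟩
    8 * (m * lowSum m + m * lowSum m)              ≤⟨ *-monoʳ-≤ 8 (+-mono-≤ (*-monoʳ-≤ m lowSum-≤′) (*-monoʳ-≤ m lowSum-≤′)) ⟩
    8 * (m * (m * (k + k)) + m * (m * (k + k)))    ≡⟨ identity m k ⟩
    -- The factor 32 is 8 from `cost`, times 2 for the two coordinates, times 2 from k + 1 ≤ 2k; it
    -- is rounded up to 40.
    32 * k * (m * m)                               ≤⟨ *-monoˡ-≤ (m * m) (*-monoˡ-≤ k (m≤m+n 32 8)) ⟩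
    40 * k * (m * m)                               ≡⟨ cong (40 * k *_) edge-count ⟨
    40 * k * length lengths                        ∎)
  where
  open ≤-Reasoning
  m = suc m′
  k = suc k′
  open GridTree (suc m)
  edges = nonTreeEdges spanningTree
  lengths = map (λ e → cycleLength (fundamentalCycle spanningTree e)) edges
  identity : ∀ m k → 8 * (m * (m * (k + k)) + m * (m * (k + k))) ≡ 32 * k * (m * m)
  identity = solve-∀
  lowSum-≤′ : lowSum m ≤ m * (k + k)
  -- Only m < 2 ^ (k + 1) is available, giving the factor k + 1, which is at most k + k since k ≥ 1.
  lowSum-≤′ = ≤-trans (lowSum-≤ (suc k) m (<-trans (n<1+n m) n<2^1+k)) (*-monoʳ-≤ m (+-monoˡ-≤ k (s≤s z≤n)))
  edge-count : length lengths ≡ m * m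
  edge-count = trans (length-map _ edges) (trans (sym (length-map key edges)) (trans (↭.↭-length (keys-↭ m))
    (trans (length-cartesianProduct (downFrom m) (downFrom m)) (cong₂ _*_ (length-downFrom m) (length-downFrom m)))))
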